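{- The graph $\mathcal Y$ defined in the context is $K_4$-UH, i.e. every isomorphism between two induced subgraphs of $\mathcal Y$ isomorphic to $K_4$ extends to an automorphism of $\mathcal Y$.
   Context: The Biggs-Smith graph $\mathcal S$ is the cubic graph on the $102$ vertices $A_i,B_i,C_i,D_i,E_i,F_i$ ($i\in\mathbb Z_{17}$) whose edges are, for every $i\in\mathbb Z_{17}$: $A_iA_{i+1}$, $D_iD_{i+2}$, $C_iC_{i+4}$, $F_iF_{i+8}$, $A_iB_i$, $B_iC_i$, $D_iE_i$, $E_iF_i$, $B_iE_i$ (indices mod $17$). The graph $\mathcal Y$ has vertex set $V(\mathcal S)$, and two distinct vertices $u,v$ are adjacent in $\mathcal Y$ iff there is a $9$-cycle $(v_0,v_1,\dots,v_8)$ of $\mathcal S$ and an index $i$ with $\{u,v\}=\{v_i,v_{i+3}\}$ (indices mod $9$). -}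

module Defs where

open import Data.Nat using (ℕ; _+_; NonZero)
open import Data.Nat.DivMod using (_%_; m%n<n)
open import Data.Fin using (Fin; toℕ; fromℕ<)
open import Data.Product using (_×_; _,_; ∃; ∃-syntax)
open import Data.Sum using (_⊎_)
open import Relation.Binary.PropositionalEquality using (_≡_; _≢_)
open import Function.Bundles using (_↔_; _⇔_; Inverse)

infixl 6 _⊕_
_⊕_ : ∀ {n} .{{_ : NonZero n}} → Fin n → ℕ → Fin n
_⊕_ {n} i k = fromℕ< (m%n<n (toℕ i + k) n)

data Letter : Set where
  A B C D E F : Letter

-- vertices of the Biggs-Smith graph: X_i with X ∈ {A,…,F}, i ∈ ℤ₁₇
V : Set
V = Letter × Fin 17

data SEdge : V → V → Set where
  aa : ∀ i → SEdge (A , i) (A , i ⊕ 1)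
  dd : ∀ i → SEdge (D , i) (D , i ⊕ 2)
  cc : ∀ i → SEdge (C , i) (C , i ⊕ 4)
  ff : ∀ i → SEdge (F , i) (F , i ⊕ 8)
  ab : ∀ i → SEdge (A , i) (B , i)
  bc : ∀ i → SEdge (B , i) (C , i)
  de : ∀ i → SEdge (D , i) (E , i)
  ef : ∀ i → SEdge (E , i) (F , i)
  be : ∀ i → SEdge (B , i) (E , i)

SAdj : V → V → Set
SAdj u v = SEdge u v ⊎ SEdge v u

record Cycle9 : Set where
  field
    vtx  : Fin 9 → V
    inj  : ∀ i j → vtx i ≡ vtx j → i ≡ j
    adj  : ∀ i → SAdj (vtx i) (vtx (i ⊕ 1))
open Cycle9 public

YAdj : V → V → Set
YAdj u v = u ≢ v × ∃[ c ] ∃[ i ]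
  ((u ≡ vtx c i × v ≡ vtx c (i ⊕ 3)) ⊎ (v ≡ vtx c i × u ≡ vtx c (i ⊕ 3)))

record YAut : Set where
  field
    perm     : V ↔ V
    preserve : ∀ u v → YAdj u v ⇔ YAdj (Inverse.to perm u) (Inverse.to perm v)
open YAut public

record YK4 : Set where
  field
    pt   : Fin 4 → V
    inj4 : ∀ i j → pt i ≡ pt j → i ≡ j
    clq  : ∀ i j → i ≢ j → YAdj (pt i) (pt j)
open YK4 public

{-# OPTIONS --safe #-}
-- Vertices adjacent in Y are joined by a path of length 3 in S, and automorphisms
-- of S permute its 9-cycles, hence act on Y.  The group generated by the rotation ρ,
-- the multiplier ν and one further involution τ is transitive on vertices; the
-- stabiliser of A₀ is transitive on the twelve vertices at distance 3 from A₀;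
-- and A₀, B₂ have just two common Y-neighbours B₁₅, D₀, which are swapped by an
-- automorphism fixing A₀ and B₂.  So every ordered K₄ of Y can be moved to
-- (A₀, B₂, B₁₅, D₀).
module Submission where

open import Defs
open import Data.Empty using (⊥-elim)
open import Data.Fin using (Fin; zero; suc; toℕ)
open import Data.Fin.Properties using (toℕ-injective; toℕ-fromℕ<; toℕ<n; all?) renaming (_≟_ to _≟F_)
open import Data.List using (List; []; _∷_; filter; concatMap)
open import Data.List.Membership.Propositional.Properties using (∈-concatMap⁺; ∈-filter⁺)
open import Data.List.Relation.Unary.All as All using (All)
open import Data.List.Relation.Unary.Any as Any using (Any; here; there)
open import Data.Nat using (ℕ; zero; suc; _+_; _*_; _∸_; NonZero)
open import Data.Nat.DivMod using (_%_; m%n%n≡m%n; %-distribˡ-+; [m+n]%n≡m%n; m<n⇒m%n≡m)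
open import Data.Nat.Properties using (+-assoc) renaming (_≟_ to _≟ℕ_)
open import Data.Product using (_×_; _,_; proj₁; proj₂; ∃-syntax)
open import Data.Product.Properties using (≡-dec)
open import Data.Sum using (_⊎_; inj₁; inj₂; swap)
open import Data.Vec using (Vec; []; _∷_; lookup)
open import Function using (_∘_; id)
open import Function.Bundles using (Inverse; mk⇔; mk↔ₛ′)
open import Level using (Level)
open import Relation.Binary.Definitions using (DecidableEquality)
open import Relation.Binary.PropositionalEquality using (_≡_; _≢_; refl; sym; trans; cong; subst; subst₂; module ≡-Reasoning)
open import Relation.Nullary using (Dec)
open import Relation.Nullary.Decidable using (map′; ¬?; _×-dec_; from-yes; True; toWitness; _→-dec_)
open import Relation.Unary using (Pred; Decidable)

private variable
  ℓ : Level

-- Arithmetic modulo n.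

⊕-⊕ : ∀ {n} .{{_ : NonZero n}} (i : Fin n) (a b : ℕ) → i ⊕ a ⊕ b ≡ i ⊕ (a + b)
⊕-⊕ {n} i a b = toℕ-injective (begin
  toℕ (i ⊕ a ⊕ b)                        ≡⟨ toℕ-fromℕ< _ ⟩
  (toℕ (i ⊕ a) + b) % n                  ≡⟨ cong (λ x → (x + b) % n) (toℕ-fromℕ< _) ⟩
  ((toℕ i + a) % n + b) % n              ≡⟨ %-distribˡ-+ ((toℕ i + a) % n) b n ⟩
  ((toℕ i + a) % n % n + b % n) % n      ≡⟨ cong (λ x → (x + b % n) % n) (m%n%n≡m%n (toℕ i + a) n) ⟩
  ((toℕ i + a) % n + b % n) % n          ≡⟨ %-distribˡ-+ (toℕ i + a) b n ⟨
  (toℕ i + a + b) % n                    ≡⟨ cong (_% n) (+-assoc (toℕ i) a b) ⟩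
  (toℕ i + (a + b)) % n                  ≡⟨ toℕ-fromℕ< _ ⟨
  toℕ (i ⊕ (a + b))                      ∎)
  where open ≡-Reasoning

⊕-period : ∀ {n} .{{_ : NonZero n}} (i : Fin n) → i ⊕ n ≡ i
⊕-period {n} i = toℕ-injective (begin
  toℕ (i ⊕ n)      ≡⟨ toℕ-fromℕ< _ ⟩
  (toℕ i + n) % n  ≡⟨ [m+n]%n≡m%n (toℕ i) n ⟩
  toℕ i % n        ≡⟨ m<n⇒m%n≡m (toℕ<n i) ⟩
  toℕ i            ∎)
  where open ≡-Reasoning

⊕-inverse : ∀ {n} .{{_ : NonZero n}} (i : Fin n) a b → a + b ≡ n → i ⊕ a ⊕ b ≡ i
⊕-inverse i a b refl = trans (⊕-⊕ i a b) (⊕-period i)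

-- Decidability over the 102 vertices.

letterCode : Letter → ℕ
letterCode A = 0
letterCode B = 1
letterCode C = 2
letterCode D = 3
letterCode E = 4
letterCode F = 5

letterDecode : ℕ → Letter
letterDecode 0 = A
letterDecode 1 = B
letterDecode 2 = C
letterDecode 3 = D
letterDecode 4 = E
letterDecode _ = F

letterDecode-code : ∀ X → letterDecode (letterCode X) ≡ X
letterDecode-code A = refl
letterDecode-code B = refl
letterDecode-code C = refl
letterDecode-code D = refl
letterDecode-code E = refl
letterDecode-code F = refl

-- Equality is pulled back along the injection `letterCode`, which avoids a match on 36 pairs.
_≟L_ : DecidableEquality Letter
X ≟L Y = map′
  (λ eq → trans (sym (letterDecode-code X)) (trans (cong letterDecode eq) (letterDecode-code Y)))
  (cong letterCode)
  (letterCode X ≟ℕ letterCode Y)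

_≟V_ : DecidableEquality V
_≟V_ = ≡-dec _≟L_ _≟F_

open import Data.List.Membership.DecPropositional _≟V_ using (_∈_; _∈?_; lose)

allLetters? : {P : Pred Letter ℓ} → Decidable P → Dec (∀ X → P X)
allLetters? P? = map′
  (λ { (a , b , c , d , e , f) → λ { A → a ; B → b ; C → c ; D → d ; E → e ; F → f } })
  (λ h → h A , h B , h C , h D , h E , h F)
  (P? A ×-dec P? B ×-dec P? C ×-dec P? D ×-dec P? E ×-dec P? F)

allV? : {P : Pred V ℓ} → Decidable P → Dec (∀ v → P v)
allV? P? = map′ (λ h v → h (proj₁ v) (proj₂ v)) (λ h X i → h (X , i))
  (allLetters? λ X → all? λ i → P? (X , i))

infix 8 _at_
-- The index is reduced mod 17, so unreduced products such as `2 * toℕ i` may be passed.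
_at_ : Letter → ℕ → V
X at n = X , zero ⊕ n

-- Adjacency as list membership, and walks of length 3.

nbr : V → List V
-- `_⊕_` adds naturals only, so a step back by k is written as a step forward by 17 - k.
nbr (A , i) = (A , i ⊕ 1) ∷ (A , i ⊕ 16) ∷ (B , i) ∷ []
nbr (B , i) = (A , i) ∷ (C , i) ∷ (E , i) ∷ []
nbr (C , i) = (C , i ⊕ 4) ∷ (C , i ⊕ 13) ∷ (B , i) ∷ []
nbr (D , i) = (D , i ⊕ 2) ∷ (D , i ⊕ 15) ∷ (E , i) ∷ []
nbr (E , i) = (D , i) ∷ (F , i) ∷ (B , i) ∷ []
nbr (F , i) = (F , i ⊕ 8) ∷ (F , i ⊕ 9) ∷ (E , i) ∷ []

SAdj⇒∈nbr : ∀ {u v} → SAdj u v → v ∈ nbr u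
SAdj⇒∈nbr (inj₁ (aa i)) = here refl
SAdj⇒∈nbr (inj₁ (dd i)) = here refl
SAdj⇒∈nbr (inj₁ (cc i)) = here refl
SAdj⇒∈nbr (inj₁ (ff i)) = here refl
SAdj⇒∈nbr (inj₁ (ab i)) = there (there (here refl))
SAdj⇒∈nbr (inj₁ (bc i)) = there (here refl)
SAdj⇒∈nbr (inj₁ (de i)) = there (there (here refl))
SAdj⇒∈nbr (inj₁ (ef i)) = there (here refl)
SAdj⇒∈nbr (inj₁ (be i)) = there (there (here refl))
SAdj⇒∈nbr (inj₂ (aa i)) = there (here (cong (A ,_) (sym (⊕-inverse i 1 16 refl))))
SAdj⇒∈nbr (inj₂ (dd i)) = there (here (cong (D ,_) (sym (⊕-inverse i 2 15 refl))))
SAdj⇒∈nbr (inj₂ (cc i)) = there (here (cong (C ,_) (sym (⊕-inverse i 4 13 refl))))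
SAdj⇒∈nbr (inj₂ (ff i)) = there (here (cong (F ,_) (sym (⊕-inverse i 8 9 refl))))
SAdj⇒∈nbr (inj₂ (ab i)) = here refl
SAdj⇒∈nbr (inj₂ (bc i)) = there (there (here refl))
SAdj⇒∈nbr (inj₂ (de i)) = here refl
SAdj⇒∈nbr (inj₂ (ef i)) = there (there (here refl))
SAdj⇒∈nbr (inj₂ (be i)) = there (there (here refl))

∈nbr⇒SAdj : ∀ {u v} → v ∈ nbr u → SAdj u v
∈nbr⇒SAdj {A , i} (here refl)                 = inj₁ (aa i)
∈nbr⇒SAdj {A , i} (there (here refl))         =
  inj₂ (subst (λ j → SEdge (A , i ⊕ 16) (A , j)) (⊕-inverse i 16 1 refl) (aa (i ⊕ 16)))
∈nbr⇒SAdj {A , i} (there (there (here refl))) = inj₁ (ab i)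
∈nbr⇒SAdj {B , i} (here refl)                 = inj₂ (ab i)
∈nbr⇒SAdj {B , i} (there (here refl))         = inj₁ (bc i)
∈nbr⇒SAdj {B , i} (there (there (here refl))) = inj₁ (be i)
∈nbr⇒SAdj {C , i} (here refl)                 = inj₁ (cc i)
∈nbr⇒SAdj {C , i} (there (here refl))         =
  inj₂ (subst (λ j → SEdge (C , i ⊕ 13) (C , j)) (⊕-inverse i 13 4 refl) (cc (i ⊕ 13)))
∈nbr⇒SAdj {C , i} (there (there (here refl))) = inj₂ (bc i)
∈nbr⇒SAdj {D , i} (here refl)                 = inj₁ (dd i)
∈nbr⇒SAdj {D , i} (there (here refl))         =
  inj₂ (subst (λ j → SEdge (D , i ⊕ 15) (D , j)) (⊕-inverse i 15 2 refl) (dd (i ⊕ 15)))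
∈nbr⇒SAdj {D , i} (there (there (here refl))) = inj₁ (de i)
∈nbr⇒SAdj {E , i} (here refl)                 = inj₂ (de i)
∈nbr⇒SAdj {E , i} (there (here refl))         = inj₁ (ef i)
∈nbr⇒SAdj {E , i} (there (there (here refl))) = inj₂ (be i)
∈nbr⇒SAdj {F , i} (here refl)                 = inj₁ (ff i)
∈nbr⇒SAdj {F , i} (there (here refl))         =
  inj₂ (subst (λ j → SEdge (F , i ⊕ 9) (F , j)) (⊕-inverse i 9 8 refl) (ff (i ⊕ 9)))
∈nbr⇒SAdj {F , i} (there (there (here refl))) = inj₂ (ef i)

nbrExcept : V → V → List V
nbrExcept u v = filter (λ w → ¬? (w ≟V u)) (nbr v)

-- As S has girth 9, the ends of the non-backtracking walks of length 3 from u form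
-- the sphere of radius 3 about u.
arc₃Ends : V → List V
arc₃Ends u = concatMap (λ x → concatMap (nbrExcept x) (nbrExcept u x)) (nbr u)

∈-nbrExcept : ∀ {u v w} → SAdj v w → w ≢ u → w ∈ nbrExcept u v
∈-nbrExcept vw w≢u = ∈-filter⁺ (λ w → ¬? (w ≟V _)) (SAdj⇒∈nbr vw) w≢u

∈-arc₃Ends : ∀ {u x y v} → SAdj u x → SAdj x y → SAdj y v → y ≢ u → v ≢ x → v ∈ arc₃Ends u
∈-arc₃Ends {u} {x} ux xy yv y≢u v≢x =
  ∈-concatMap⁺ (λ x → concatMap (nbrExcept x) (nbrExcept u x)) (lose (SAdj⇒∈nbr ux)
    (∈-concatMap⁺ (nbrExcept x) (lose (∈-nbrExcept xy y≢u) (∈-nbrExcept yv v≢x))))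

-- Three consecutive edges of a 9-cycle form a non-backtracking walk, and it can be read from either
-- end.
cycle-arc₃ : (c : Cycle9) (i : Fin 9) →
  (vtx c (i ⊕ 3) ∈ arc₃Ends (vtx c i)) × (vtx c i ∈ arc₃Ends (vtx c (i ⊕ 3)))
cycle-arc₃ c i = subst (λ j → (vtx c j ∈ arc₃Ends (vtx c i)) × (vtx c i ∈ arc₃Ends (vtx c j)))
  (trans (⊕-⊕ (i ⊕ 1) 1 1) (⊕-⊕ i 1 2))
  ( ∈-arc₃Ends (adj c i) (adj c i₁) (adj c i₂) (skip i) (skip i₁)
  , ∈-arc₃Ends (swap (adj c i₂)) (swap (adj c i₁)) (swap (adj c i)) (skip i₁ ∘ sym) (skip i ∘ sym) )
  where
  i₁ i₂ : Fin 9
  i₁ = i ⊕ 1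
  i₂ = i₁ ⊕ 1
  skip : ∀ j → vtx c (j ⊕ 1 ⊕ 1) ≢ vtx c j
  -- Adding 2 has no fixed point in the integers mod 9, and the vertices of a cycle are distinct.
  skip j eq = from-yes (all? λ (j : Fin 9) → ¬? (j ⊕ 1 ⊕ 1 ≟F j)) j (inj c _ _ eq)

-- This trades the existential over 9-cycles for a list of twelve vertices, so the later checks
-- never enumerate cycles.
YAdj⇒∈arc₃Ends : ∀ {u v} → YAdj u v → v ∈ arc₃Ends u
YAdj⇒∈arc₃Ends (_ , c , i , inj₁ (refl , refl)) = proj₁ (cycle-arc₃ c i)
YAdj⇒∈arc₃Ends (_ , c , i , inj₂ (refl , refl)) = proj₂ (cycle-arc₃ c i)

-- Automorphisms of the cubic graph and their action on `YAdj`.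

record SAut : Set where
  field
    to       : V → V
    from     : V → V
    to-from  : ∀ v → to (from v) ≡ v
    from-to  : ∀ v → from (to v) ≡ v
    to-adj   : ∀ {u v} → SAdj u v → SAdj (to u) (to v)
    from-adj : ∀ {u v} → SAdj u v → SAdj (from u) (from v)
open SAut

infixr 9 _∙_
infix 10 _⁻¹
infix 11 _^_

_∙_ : SAut → SAut → SAut
to       (f ∙ g)    = to f ∘ to g
from     (f ∙ g)    = from g ∘ from f
to-from  (f ∙ g) v  = trans (cong (to f) (to-from g (from f v))) (to-from f v)
from-to  (f ∙ g) v  = trans (cong (from g) (from-to f (to g v))) (from-to g v)
to-adj   (f ∙ g)    = to-adj f ∘ to-adj g
from-adj (f ∙ g)    = from-adj g ∘ from-adj f

_⁻¹ : SAut → SAut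
to       (f ⁻¹) = from f
from     (f ⁻¹) = to f
to-from  (f ⁻¹) = from-to f
from-to  (f ⁻¹) = to-from f
to-adj   (f ⁻¹) = from-adj f
from-adj (f ⁻¹) = to-adj f

ι : SAut
to       ι   = id
from     ι   = id
to-from  ι _ = refl
from-to  ι _ = refl
to-adj   ι   = id
from-adj ι   = id

_^_ : SAut → ℕ → SAut
f ^ zero  = ι
f ^ suc n = f ∙ f ^ n

mapCycle9 : SAut → Cycle9 → Cycle9
vtx (mapCycle9 f c)         = to f ∘ vtx c
inj (mapCycle9 f c) i j eq  =
  inj c i j (trans (sym (from-to f _)) (trans (cong (from f) eq) (from-to f _)))
adj (mapCycle9 f c) i       = to-adj f (adj c i)

to-YAdj : ∀ f {u v} → YAdj u v → YAdj (to f u) (to f v)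
to-YAdj f (u≢v , c , i , e) =
  (λ eq → u≢v (trans (sym (from-to f _)) (trans (cong (from f) eq) (from-to f _)))) ,
  mapCycle9 f c , i , image e
  where
  image : ∀ {u v x y} → (u ≡ x × v ≡ y) ⊎ (v ≡ x × u ≡ y) →
          (to f u ≡ to f x × to f v ≡ to f y) ⊎ (to f v ≡ to f x × to f u ≡ to f y)
  image (inj₁ (p , q)) = inj₁ (cong (to f) p , cong (to f) q)
  image (inj₂ (p , q)) = inj₂ (cong (to f) p , cong (to f) q)

SAut⇒YAut : SAut → YAut
perm     (SAut⇒YAut f)     = mk↔ₛ′ (to f) (from f) (to-from f) (from-to f)
preserve (SAut⇒YAut f) u v = mk⇔ (to-YAdj f)
  (λ y → subst₂ YAdj (from-to f u) (from-to f v) (to-YAdj (f ⁻¹) y))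

-- Automorphisms certified by evaluation.

IsLeftInverse : (f g : V → V) → Set
IsLeftInverse f g = ∀ v → f (g v) ≡ v

isLeftInverse? : ∀ f g → Dec (IsLeftInverse f g)
isLeftInverse? f g = allV? λ v → f (g v) ≟V v

PreservesNbr : (V → V) → Set
PreservesNbr f = ∀ u → All (λ v → f v ∈ nbr (f u)) (nbr u)

preservesNbr? : ∀ f → Dec (PreservesNbr f)
preservesNbr? f = allV? λ u → All.all? (λ v → f v ∈? nbr (f u)) (nbr u)

PreservesNbr⇒SAdj : ∀ {f} → PreservesNbr f → ∀ {u v} → SAdj u v → SAdj (f u) (f v)
PreservesNbr⇒SAdj pres uv = ∈nbr⇒SAdj (All.lookup (pres _) (SAdj⇒∈nbr uv))

-- Once a decision procedure evaluates to yes on concrete maps, its `True` argument is the unit type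
-- and is filled in automatically; only the two maps have to be supplied.
checkedAut : (f g : V → V) →
  {True (isLeftInverse? f g)} → {True (isLeftInverse? g f)} →
  {True (preservesNbr? f)} → {True (preservesNbr? g)} → SAut
to       (checkedAut f g)             = f
from     (checkedAut f g)             = g
to-from  (checkedAut f g {p})         = toWitness p
from-to  (checkedAut f g {_} {p})     = toWitness p
to-adj   (checkedAut f g {_} {_} {p}) = PreservesNbr⇒SAdj (toWitness p)
from-adj (checkedAut f g {_} {_} {_} {p}) = PreservesNbr⇒SAdj (toWitness p)

-- The generators.

ρ : SAut
ρ = checkedAut (λ { (X , i) → X , i ⊕ 1 }) (λ { (X , i) → X , i ⊕ 16 })

-- Doubling the index turns the steps 1, 2, 4, 8 of A, D, C, F into 2, 4, 8, −1.
double : Letter → Letter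
double A = D
double D = C
double C = F
double F = A
double B = E
double E = B

ν : SAut
ν = checkedAut (λ { (X , i) → double X at (2 * toℕ i) })
               -- `double` has order 4, so its cube is its inverse; 9 is the inverse of 2 mod 17.
               (λ { (X , i) → double (double (double X)) at (9 * toℕ i) })

-- The involution fixing A₋₁, A₀, A₁ and B₀ and exchanging A₂ with B₁.
τ-row : Letter → Vec V 17
τ-row A =
  A at 0 ∷ A at 1 ∷ B at 1 ∷ C at 1 ∷ C at 5 ∷ B at 5 ∷
  E at 5 ∷ F at 5 ∷ F at 13 ∷ F at 4 ∷ F at 12 ∷ E at 12 ∷
  B at 12 ∷ C at 12 ∷ C at 16 ∷ B at 16 ∷ A at 16 ∷ []
τ-row B =
  B at 0 ∷ A at 2 ∷ E at 1 ∷ C at 14 ∷ C at 9 ∷ A at 5 ∷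
  D at 5 ∷ F at 14 ∷ E at 13 ∷ E at 4 ∷ F at 3 ∷ D at 12 ∷
  A at 12 ∷ C at 8 ∷ C at 3 ∷ E at 16 ∷ A at 15 ∷ []
τ-row C =
  C at 0 ∷ A at 3 ∷ D at 1 ∷ B at 14 ∷ C at 13 ∷ A at 4 ∷
  D at 3 ∷ E at 14 ∷ B at 13 ∷ B at 4 ∷ E at 3 ∷ D at 14 ∷
  A at 13 ∷ C at 4 ∷ B at 3 ∷ D at 16 ∷ A at 14 ∷ []
τ-row D =
  F at 0 ∷ C at 2 ∷ F at 9 ∷ C at 6 ∷ E at 9 ∷ B at 6 ∷
  D at 9 ∷ E at 6 ∷ D at 11 ∷ D at 6 ∷ E at 11 ∷ D at 8 ∷
  B at 11 ∷ E at 8 ∷ C at 11 ∷ F at 8 ∷ C at 15 ∷ []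
τ-row E =
  E at 0 ∷ B at 2 ∷ F at 1 ∷ C at 10 ∷ B at 9 ∷ A at 6 ∷
  D at 7 ∷ F at 6 ∷ D at 13 ∷ D at 4 ∷ F at 11 ∷ D at 10 ∷
  A at 11 ∷ B at 8 ∷ C at 7 ∷ F at 16 ∷ B at 15 ∷ []
τ-row F =
  D at 0 ∷ E at 2 ∷ F at 10 ∷ B at 10 ∷ A at 9 ∷ A at 7 ∷
  E at 7 ∷ F at 15 ∷ D at 15 ∷ D at 2 ∷ F at 2 ∷ E at 10 ∷
  A at 10 ∷ A at 8 ∷ B at 7 ∷ F at 7 ∷ E at 15 ∷ []

τ : SAut
τ = checkedAut τ-map τ-map
  where
  τ-map : V → V
  τ-map (X , i) = lookup (τ-row X) i

-- Transitivity on vertices and on arcs.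

A₀ B₂ B₁₅ D₀ : V
A₀  = A at 0
B₂  = B at 2
B₁₅ = B at 15
D₀  = D at 0

-- Only index 0 of each row has to reach `A₀`. Powers of `ν` fix that index and cycle the rows A, D,
-- C, F. For row B, reading right to left, B₀ goes to B₁, then under `τ` to A₂, then back by two;
-- row E first enters row B by `ν`.
rowToA₀ : Letter → SAut
rowToA₀ A = ι
rowToA₀ B = ρ ^ 15 ∙ τ ∙ ρ
rowToA₀ C = ν ^ 2
rowToA₀ D = ν ^ 3
rowToA₀ E = ρ ^ 15 ∙ τ ∙ ρ ∙ ν
rowToA₀ F = ν

toA₀ : V → SAut
-- For index 0 the exponent is 17, and `ρ ^ 17` acts as the identity.
toA₀ (X , i) = rowToA₀ X ∙ ρ ^ (17 ∸ toℕ i)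

toA₀-correct : ∀ u → to (toA₀ u) u ≡ A₀
toA₀-correct = from-yes (allV? λ u → to (toA₀ u) u ≟V A₀)

-- Abstract, since the type checker would otherwise unfold the automorphism found.
abstract
  vertex-transitive : ∀ u → ∃[ f ] to f u ≡ A₀
  vertex-transitive u = toA₀ u , toA₀-correct u

-- Each of these fixes A₀, and they send B₂ to the twelve ends of 3-arcs at A₀.
stabiliser-A₀ : List SAut
stabiliser-A₀ =
  ι ∷ τ ∷ n ∷ n ∙ τ ∷ k ∷ l ∷ k ∙ τ ∷ τ ∙ k ∷ n ∙ l ∷ n ∙ τ ∙ l ∷ τ ∙ l ∷ τ ∙ k ∙ τ ∷ []
  where
  n k l : SAut
  -- Since 2⁴ = -1 mod 17 and `double` has order 4, this is the reflection of the index, i to -i.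
  n = ν ^ 4
  -- Both conjugates of `τ` fix `A₀` because `τ` fixes A₁ and A₋₁.
  k = ρ ^ 16 ∙ τ ∙ ρ
  l = ρ ∙ τ ∙ ρ ^ 16

-- The listed automorphisms lead from `B₂` to v, hence the use of `from`; `∃-inverse` later reverses
-- the direction.
stabiliser-A₀-orbit : All (λ v → Any (λ f → from f A₀ ≡ A₀ × from f v ≡ B₂) stabiliser-A₀) (arc₃Ends A₀)
stabiliser-A₀-orbit = from-yes (All.all?
  (λ v → Any.any? (λ f → (from f A₀ ≟V A₀) ×-dec (from f v ≟V B₂)) stabiliser-A₀) (arc₃Ends A₀))

∃-inverse : ∀ {u v x y} → ∃[ f ] (from f u ≡ x × from f v ≡ y) → ∃[ f ] (to f u ≡ x × to f v ≡ y)
∃-inverse (f , p) = f ⁻¹ , p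

abstract
  stabiliser-A₀-transitive : ∀ {v} → YAdj A₀ v → ∃[ f ] (to f A₀ ≡ A₀ × to f v ≡ B₂)
  stabiliser-A₀-transitive y =
    ∃-inverse (Any.satisfied (All.lookup stabiliser-A₀-orbit (YAdj⇒∈arc₃Ends y)))

arc-transitive : ∀ {u v} → YAdj u v → ∃[ f ] (to f u ≡ A₀ × to f v ≡ B₂)
arc-transitive {u} {v} y with vertex-transitive u
... | f , fu≡A₀ with stabiliser-A₀-transitive (subst (λ w → YAdj w (to f v)) fu≡A₀ (to-YAdj f y))
... | g , gA₀≡A₀ , gfv≡B₂ = g ∙ f , trans (cong (to g) fu≡A₀) gA₀≡A₀ , gfv≡B₂

-- Completing an arc to a clique.

-- Evaluation intersects the two lists of walk ends; every common neighbour under `YAdj` lies in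
-- this intersection.
arc₃Ends-A₀-B₂ : All (λ w → w ∈ arc₃Ends B₂ → w ∈ B₁₅ ∷ D₀ ∷ []) (arc₃Ends A₀)
arc₃Ends-A₀-B₂ = from-yes (All.all?
  (λ w → (w ∈? arc₃Ends B₂) →-dec (w ∈? B₁₅ ∷ D₀ ∷ [])) (arc₃Ends A₀))

abstract
  common-neighbours : ∀ {w} → YAdj A₀ w → YAdj B₂ w → w ∈ B₁₅ ∷ D₀ ∷ []
  common-neighbours aw bw = All.lookup arc₃Ends-A₀-B₂ (YAdj⇒∈arc₃Ends aw) (YAdj⇒∈arc₃Ends bw)

swap-common : ∀ {w x} → w ∈ B₁₅ ∷ D₀ ∷ [] → x ∈ B₁₅ ∷ D₀ ∷ [] → w ≢ x →
  ∃[ f ] (to f A₀ ≡ A₀ × to f B₂ ≡ B₂ × to f w ≡ B₁₅ × to f x ≡ D₀)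
swap-common (here refl)         (here refl)         w≢x = ⊥-elim (w≢x refl)
swap-common (here refl)         (there (here refl)) _   = ι , refl , refl , refl , refl
swap-common (there (here refl)) (here refl)         _   =
  -- This is `τ` conjugated by `τ ∙ ρ`. The inverse of `τ ∙ ρ` takes `A₀` and `B₂` to A₋₁ and E₀,
  -- which `τ` fixes, and takes `D₀` and `B₁₅` to F₁₆ and E₁₅, which `τ` exchanges.
  τ ∙ ρ ∙ τ ∙ ρ ^ 16 ∙ τ , refl , refl , refl , refl
swap-common (there (here refl)) (there (here refl)) w≢x = ⊥-elim (w≢x refl)

base : Fin 4 → V
base = lookup (A₀ ∷ B₂ ∷ B₁₅ ∷ D₀ ∷ [])

image-clq : ∀ K f {i j z} → to f (pt K i) ≡ z → i ≢ j → YAdj z (to f (pt K j))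
image-clq K f refl i≢j = to-YAdj f (clq K _ _ i≢j)

to-base : (K : YK4) → ∃[ f ] (∀ i → to f (pt K i) ≡ base i)
to-base K with arc-transitive (clq K zero (suc zero) λ ())
... | f , f₀ , f₁ with swap-common
        (common-neighbours (image-clq K f f₀ λ ()) (image-clq K f f₁ λ ()))
        (common-neighbours (image-clq K f f₀ λ ()) (image-clq K f f₁ λ ()))
        -- The first component of an adjacency is the distinctness of its ends, so the last two
        -- points occupy both remaining places.
        (proj₁ (to-YAdj f (clq K (suc (suc zero)) (suc (suc (suc zero))) λ ())))
... | g , g₀ , g₁ , g₂ , g₃ = g ∙ f , λ
  { zero                   → trans (cong (to g) f₀) g₀
  ; (suc zero)             → trans (cong (to g) f₁) g₁
  ; (suc (suc zero))       → g₂
  ; (suc (suc (suc zero))) → g₃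
  }

theorem6 : (K L : YK4) →
    ∃[ σ ] (∀ (i : Fin 4) → Inverse.to (perm σ) (pt K i) ≡ pt L i)
theorem6 K L with to-base K | to-base L
-- The enumerations of both cliques are arbitrary, so matching them index by index covers every
-- isomorphism.
... | f , fK | g , gL = SAut⇒YAut (g ⁻¹ ∙ f) ,
  λ i → trans (cong (from g) (trans (fK i) (sym (gL i)))) (from-to g (pt L i))
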